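{- Let $T$ denote the chair tiling. The smallest number of colours needed to colour the faces of $T$ is $3$. Moreover, a 3-colouring of the faces can be obtained by colouring the four first level supertiles, based on orientation, in the following way. Each first level supertile occupies a $4\times4$ axis-parallel square $Q$ with one of its four $2\times2$ quadrants removed (the four orientations correspond to which quadrant is removed), and consists of four tiles: three tiles each contained in one of the three remaining quadrants of $Q$, and one central tile contained in none of the quadrants. Colour the central tile green; colour each of the other three tiles red if it lies in the bottom-left or the top-right quadrant of $Q$, and blue if it lies in the top-left or the bottom-right quadrant of $Q$.
   Context: Chair substitution. The prototile is the L-shaped polygon $C=\overline{[0,2]^2\setminus[1,2]^2}$ (a union of three unit squares). The substitution $\omega$ replaces $C$ by the dissection of $2C=\overline{[0,4]^2\setminus[2,4]^2}$ into four tiles congruent to $C$: the tile $C$; the tile $C+(1,1)$; the tile $\overline{[0,2]\times[2,4]\setminus[1,2]\times[2,3]}$; and the tile $\overline{[2,4]\times[0,2]\setminus[2,3]\times[1,2]}$. It is extended to translates and rotations (by multiples of $90^\circ$) of $C$, and to collections of such tiles, in the obvious covariant way (expand by the factor 2, then dissect each expanded tile). The chair tiling $T$ is the fixed point tiling of the plane produced by this substitution; thus $\omega(T)=T$, and the first level supertiles of $T$ are the patches $\omega(t)$, $t\in T$. The faces of $T$ are its tiles. A colouring of the faces is an assignment of colours to the tiles such that any two distinct tiles whose boundaries share a segment of positive length have different colours. -}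

module Defs where

open import Data.Fin using (Fin)
open import Data.Integer using (ℤ; +_; -_; _+_; _-_; _*_; _≤_; _<_)
open import Data.List using (List; []; _∷_; map; concatMap)
open import Data.List.Membership.Propositional using (_∈_; _∉_)
open import Data.Nat as ℕ using (ℕ)
open import Data.Product using (∃-syntax; ∃!; _×_; _,_)
open import Data.Sum using (_⊎_)
open import Function.Bundles using (_⇔_)
open import Level using (0ℓ)
open import Relation.Binary.PropositionalEquality using (_≡_; _≢_)
open import Relation.Nullary using (¬_)
open import Relation.Unary using (Pred; _≐_)

-- All tiles of the chair tilings fixed by the substitution have integer
-- vertices, so the plane is handled through the unit squares and unit segments
-- of the lattice ℤ².

Point : Set
Point = ℤ × ℤ

infixl 6 _⊕_
_⊕_ : Point → Point → Point
(x , y) ⊕ (x′ , y′) = (x + x′ , y + y′)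

double : Point → Point
double (x , y) = (+ 2 * x , + 2 * y)

-- Counterclockwise rotations about the origin, in degrees.
data Rotation : Set where
  r0 r90 r180 r270 : Rotation

infixl 7 _∙_
_∙_ : Rotation → Rotation → Rotation
r0   ∙ s    = s
r90  ∙ r0   = r90
r90  ∙ r90  = r180
r90  ∙ r180 = r270
r90  ∙ r270 = r0
r180 ∙ r0   = r180
r180 ∙ r90  = r270
r180 ∙ r180 = r0
r180 ∙ r270 = r90
r270 ∙ r0   = r270
r270 ∙ r90  = r0
r270 ∙ r180 = r90
r270 ∙ r270 = r180

rotate : Rotation → Point → Point
rotate r0   (x , y) = (x , y)
rotate r90  (x , y) = (- y , x)
rotate r180 (x , y) = (- x , - y)
rotate r270 (x , y) = (y , - x)

-- The cell (x , y) is the unit square [x,x+1] × [y,y+1].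
Cell : Set
Cell = ℤ × ℤ

-- The lower-left corner of a rotated square is the image of another one of its
-- corners, whence the shifts by -1.
rotateCell : Rotation → Cell → Cell
rotateCell r0   (x , y) = (x , y)
rotateCell r90  (x , y) = (- y - + 1 , x)
rotateCell r180 (x , y) = (- x - + 1 , - y - + 1)
rotateCell r270 (x , y) = (y , - x - + 1)

-- (r , v) is the tile r(C) + v.  As C has no rotational symmetry, distinct pairs
-- are distinct tiles.
Tile : Set
Tile = Rotation × Point

cellsC : List Cell
cellsC = (+ 0 , + 0) ∷ (+ 1 , + 0) ∷ (+ 0 , + 1) ∷ []

cells : Tile → List Cell
cells (r , v) = map (λ c → rotateCell r c ⊕ v) cellsC

-- ω(C): the third tile is [0,2]×[2,4] without [1,2]×[2,3], the fourth is
-- [2,4]×[0,2] without [2,3]×[1,2].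
ωC : List Tile
ωC = (r0   , (+ 0 , + 0))
   ∷ (r0   , (+ 1 , + 1))
   ∷ (r270 , (+ 0 , + 4))
   ∷ (r90  , (+ 4 , + 0))
   ∷ []

-- ω(r(C) + v) = r(ω(C)) + 2v
ω : Tile → List Tile
ω (r , v) = map (λ (s , w) → (r ∙ s , rotate r w ⊕ double v)) ωC

ω⟦_⟧ : Pred Tile 0ℓ → Pred Tile 0ℓ
ω⟦ T ⟧ t = ∃[ s ] T s × t ∈ ω s

record IsTiling (T : Pred Tile 0ℓ) : Set where
  field
    covers     : ∀ c → ∃[ t ] T t × c ∈ cells t
    nonoverlap : ∀ {t u c} → T t → T u → c ∈ cells t → c ∈ cells u → t ≡ u

record IsChairTiling (T : Pred Tile 0ℓ) : Set where
  field
    isTiling : IsTiling T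
    fixed    : ω⟦ T ⟧ ≐ T

-- hor (x , y) is the segment [x,x+1] × {y}; ver (x , y) is {x} × [y,y+1].
data Segment : Set where
  hor ver : Point → Segment

side₁ side₂ : Segment → Cell
side₁ (hor (x , y)) = (x , y)
side₁ (ver (x , y)) = (x , y)
side₂ (hor (x , y)) = (x , y - + 1)
side₂ (ver (x , y)) = (x - + 1 , y)

-- A unit segment lies in the boundary of a union of cells when exactly one of
-- the two cells on its sides belongs to that union.
_∈∂_ : Segment → Tile → Set
e ∈∂ t = (side₁ e ∈ cells t × side₂ e ∉ cells t)
       ⊎ (side₁ e ∉ cells t × side₂ e ∈ cells t)

-- Boundaries of tiles are unions of lattice unit segments, so they share a
-- segment of positive length exactly when they share a lattice unit segment.
ShareSegment : Tile → Tile → Set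
ShareSegment t u = ∃[ e ] e ∈∂ t × e ∈∂ u

-- Colours are given to all of Tile; only the colours of tiles of T matter.
IsColouring : {A : Set} → Pred Tile 0ℓ → (Tile → A) → Set
IsColouring T c = ∀ {t u} → T t → T u → t ≢ u → ShareSegment t u → c t ≢ c u

Colourable : Pred Tile 0ℓ → ℕ → Set
Colourable T k = ∃[ c ] IsColouring {Fin k} T c

SmallestNumberOfColours : Pred Tile 0ℓ → ℕ → Set
SmallestNumberOfColours T n = Colourable T n × (∀ k → Colourable T k → n ℕ.≤ k)

-- InSquare n (a , b) is the set of cells of [a,a+n] × [b,b+n].
InSquare : ℕ → Point → Pred Cell 0ℓ
InSquare n (a , b) (x , y) = (a ≤ x × x < a + + n) × (b ≤ y × y < b + + n)

data Quadrant : Set where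
  bottomLeft bottomRight topLeft topRight : Quadrant

-- A 4×4 square Q is given by its lower-left corner.
InQuadrant : Point → Quadrant → Pred Cell 0ℓ
InQuadrant Q bottomLeft  = InSquare 2 Q
InQuadrant Q bottomRight = InSquare 2 (Q ⊕ (+ 2 , + 0))
InQuadrant Q topLeft     = InSquare 2 (Q ⊕ (+ 0 , + 2))
InQuadrant Q topRight    = InSquare 2 (Q ⊕ (+ 2 , + 2))

-- The union of the patch P is the 4×4 square Q without its quadrant q.
Occupies : List Tile → Point → Quadrant → Set
Occupies P Q q =
  ∀ c → c ∈ concatMap cells P ⇔ (InSquare 4 Q c × ¬ InQuadrant Q q c)

LiesIn : Tile → Point → Quadrant → Set
LiesIn t Q q = ∀ {c} → c ∈ cells t → InQuadrant Q q c

IsCentral : Tile → Point → Set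
IsCentral t Q = ∀ q → ¬ LiesIn t Q q

record SupertileShape (P : List Tile) (Q : Point) (q : Quadrant) : Set where
  field
    occupies   : Occupies P Q q
    inQuadrant : ∀ q′ → q′ ≢ q → ∃! _≡_ λ t → t ∈ P × LiesIn t Q q′
    central    : ∃! _≡_ λ t → t ∈ P × IsCentral t Q

data Colour : Set where
  red blue green : Colour

quadrantColour : Quadrant → Colour
quadrantColour bottomLeft  = red
quadrantColour topRight    = red
quadrantColour topLeft     = blue
quadrantColour bottomRight = blue

FollowsRule : Pred Tile 0ℓ → (Tile → Colour) → Set
FollowsRule T c =
  ∀ {s} → T s → ∀ Q q → Occupies (ω s) Q q → ∀ {t} → t ∈ ω s →
    (IsCentral t Q → c t ≡ green) ×
    (∀ q′ → LiesIn t Q q′ → c t ≡ quadrantColour q′)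

{-# OPTIONS --safe #-}
module Submission where

-- The rule colours a tile of T by its own data: green if the abscissa of its
-- vertex is odd, and otherwise red or blue according to its rotation.  Since
-- T = ω(T), the vertex of every tile of T has coordinates of equal parity, and so
-- a non-green tile, which lies in some square 2b + [0,2]², is red or blue
-- according to the parity of b₁ + b₂.  Now let two cells on the two sides of a
-- unit segment belong to tiles of T of the same colour.  If both tiles are red or
-- both are blue, then the cells lie in the same square 2b + [0,2]², whose centre
-- is the reflex vertex of both tiles.  If both are green, then either the cells
-- lie in the same square 2b + [0,2]², so that both tiles are the central tile of
-- the same supertile, or they touch the same point of 2ℤ², which is the reflex
-- vertex of both tiles.  Two tiles with the same reflex vertex overlap, so the
-- tiles are equal in all cases.  Conversely a supertile contains three mutually
-- adjacent tiles.  Statements on a single supertile are checked at the origin by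
-- computation and then translated.

open import Defs
open import Data.Fin as Fin using (Fin; zero; suc; toℕ; fromℕ<)
import Data.Fin.Properties as Fin
open import Data.Integer as ℤ using (ℤ; +_; -[1+_]; -_; _+_; _-_; _*_; _⊖_; _≤_; _<_; _≤?_; _<?_;
                                    ∣_∣; _/ℕ_; _%ℕ_)
open import Data.Integer.DivMod using (a≡a%ℕn+[a/ℕn]*n; n%ℕd<d)
import Data.Integer.Properties as ℤ
open import Data.Integer.Tactic.RingSolver using (solve-∀)
open import Data.List using (List; []; _∷_; map; concatMap; filter)
import Data.List.Membership.DecPropositional as DecMembership
open import Data.List.Membership.Propositional using (_∈_; find)
open import Data.List.Membership.Propositional.Properties using (∈-map⁺; ∈-map⁻; ∈-filter⁺; ∈-filter⁻)
import Data.List.Properties as List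
open import Data.List.Relation.Unary.All as All using (All)
open import Data.List.Relation.Unary.Any as Any using (Any; here; there)
open import Data.Nat as ℕ using (zero; suc; s≤s)
import Data.Nat.Properties as ℕ
open import Data.Parity as ℙ using (Parity; 0ℙ; 1ℙ)
import Data.Parity.Properties as ℙ
open import Data.Product using (∃-syntax; ∃!; _×_; _,_; proj₁; proj₂)
open import Data.Product.Properties using (≡-dec)
open import Data.Sum using (_⊎_; inj₁; inj₂)
open import Function using (_∘_; mk⇔; Equivalence)
open import Level using (0ℓ)
open import Relation.Binary using (DecidableEquality)
open import Relation.Binary.PropositionalEquality
open import Relation.Nullary using (Dec; yes; no; ¬_; ¬?; contradiction)
open import Relation.Nullary.Decidable using (from-yes; map′; _×-dec_; _⊎-dec_; _→-dec_)
open import Relation.Unary using (Pred; Decidable)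
open import Algebra.Properties.AbelianGroup ℤ.+-0-abelianGroup using (∙-cancelˡ)

-- Halving integers

parity : ℤ → Parity
parity i = ℕ.parity ∣ i ∣

-- Signs are invisible modulo 2, and lowering both arguments by one changes their sum by 2.
parity-⊖ : ∀ m n → parity (m ⊖ n) ≡ ℕ.parity m ℙ.+ ℕ.parity n
parity-⊖ m       zero    = sym (ℙ.+-identityʳ (ℕ.parity m))
parity-⊖ zero    (suc n) = refl
parity-⊖ (suc m) (suc n) = begin
  parity (suc m ⊖ suc n)                       ≡⟨ cong parity (ℤ.[1+m]⊖[1+n]≡m⊖n m n) ⟩
  parity (m ⊖ n)                               ≡⟨ parity-⊖ m n ⟩
  ℕ.parity m ℙ.+ ℕ.parity n                    ≡⟨ ℙ.+-homo-+ m n ⟨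
  ℕ.parity (suc (suc (m ℕ.+ n)))               ≡⟨ cong (λ k → ℕ.parity (suc k)) (ℕ.+-suc m n) ⟨
  ℕ.parity (suc m ℕ.+ suc n)                   ≡⟨ ℙ.+-homo-+ (suc m) (suc n) ⟩
  ℕ.parity (suc m) ℙ.+ ℕ.parity (suc n)        ∎
  where open ≡-Reasoning

parity-+ : ∀ i j → parity (i + j) ≡ parity i ℙ.+ parity j
parity-+ (+ m)    (+ n)    = ℙ.+-homo-+ m n
parity-+ (+ m)    -[1+ n ] = parity-⊖ m (suc n)
parity-+ -[1+ m ] (+ n)    = trans (parity-⊖ n (suc m)) (ℙ.+-comm (ℕ.parity n) _)
parity-+ -[1+ m ] -[1+ n ] =
  trans (cong (λ k → ℕ.parity (suc k)) (sym (ℕ.+-suc m n))) (ℙ.+-homo-+ (suc m) (suc n))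

parity-2* : ∀ i → parity (+ 2 * i) ≡ 0ℙ
parity-2* i = trans (cong ℕ.parity (ℤ.abs-* (+ 2) i)) (ℙ.*-homo-* 2 ∣ i ∣)

half : ℤ → ℤ
half i = i /ℕ 2

halves : ∀ i → i ≡ + 2 * half i ⊎ i ≡ + 1 + + 2 * half i
halves i with i %ℕ 2 | n%ℕd<d i 2 | a≡a%ℕn+[a/ℕn]*n i 2
... | 0 | _ | eq = inj₁ (trans eq (trans (ℤ.+-identityˡ _) (ℤ.*-comm (half i) (+ 2))))
... | 1 | _ | eq = inj₂ (trans eq (cong (λ k → + 1 + k) (ℤ.*-comm (half i) (+ 2))))
... | suc (suc _) | s≤s (s≤s ()) | _

2*≢1+2* : ∀ i j → + 2 * i ≢ + 1 + + 2 * j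
2*≢1+2* i j eq = contradiction 0ℙ≡1ℙ λ ()
  where
  open ≡-Reasoning
  0ℙ≡1ℙ : 0ℙ ≡ 1ℙ
  0ℙ≡1ℙ = begin
    0ℙ                        ≡⟨ parity-2* i ⟨
    parity (+ 2 * i)          ≡⟨ cong parity eq ⟩
    parity (+ 1 + + 2 * j)    ≡⟨ parity-+ (+ 1) (+ 2 * j) ⟩
    1ℙ ℙ.+ parity (+ 2 * j)   ≡⟨ cong (1ℙ ℙ.+_) (parity-2* j) ⟩
    1ℙ                        ∎

half-2* : ∀ h → half (+ 2 * h) ≡ h
half-2* h with halves (+ 2 * h)
... | inj₁ eq = sym (ℤ.*-cancelˡ-≡ (+ 2) _ _ eq)
... | inj₂ eq = contradiction eq (2*≢1+2* h (half (+ 2 * h)))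

half-1+2* : ∀ h → half (+ 1 + + 2 * h) ≡ h
half-1+2* h with halves (+ 1 + + 2 * h)
... | inj₁ eq = contradiction (sym eq) (2*≢1+2* (half (+ 1 + + 2 * h)) h)
... | inj₂ eq = sym (ℤ.*-cancelˡ-≡ (+ 2) _ _ (∙-cancelˡ (+ 1) _ _ eq))

half-+2* : ∀ i h → half (i + + 2 * h) ≡ half i + h
half-+2* i h with halves i
... | inj₁ eq = begin
  half (i + + 2 * h)             ≡⟨ cong (λ k → half (k + + 2 * h)) eq ⟩
  half (+ 2 * half i + + 2 * h)  ≡⟨ cong half (ℤ.*-distribˡ-+ (+ 2) (half i) h) ⟨
  half (+ 2 * (half i + h))      ≡⟨ half-2* (half i + h) ⟩
  half i + h                     ∎
  where open ≡-Reasoning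
... | inj₂ eq = begin
  half (i + + 2 * h)                   ≡⟨ cong (λ k → half (k + + 2 * h)) eq ⟩
  half (+ 1 + + 2 * half i + + 2 * h)  ≡⟨ cong half (factor (half i) h) ⟩
  half (+ 1 + + 2 * (half i + h))      ≡⟨ half-1+2* (half i + h) ⟩
  half i + h                           ∎
  where
  open ≡-Reasoning
  factor : ∀ q h → + 1 + + 2 * q + + 2 * h ≡ + 1 + + 2 * (q + h)
  factor = solve-∀

-- If `i` is odd, the intervals [i-1,i] and [i,i+1] lie in a common [2h,2h+2]. If `i` is even, they
-- meet at the even point `i`; twice `half (i + + 1)` is the even endpoint of [i,i+1]. The term
-- `i - + 1 + + 1` is left as it arises from `corner` applied to `side₂`.
half-pred : ∀ i → half i ≡ half (i - + 1)
                ⊎ half (i + + 1) ≡ half (i - + 1 + + 1) × half i ≡ + 1 + half (i - + 1)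
half-pred i with halves i
... | inj₁ eq = inj₂ (trans half-suc (sym (cong half (suc-pred i))) , sym 1+half-pred)
  where
  pred-double : ∀ h → + 2 * h - + 1 ≡ + 1 + + 2 * (h - + 1)
  pred-double = solve-∀
  suc-pred : ∀ h → h - + 1 + + 1 ≡ h
  suc-pred = solve-∀
  1+pred : ∀ h → + 1 + (h - + 1) ≡ h
  1+pred = solve-∀
  open ≡-Reasoning
  half-suc : half (i + + 1) ≡ half i
  half-suc = begin
    half (i + + 1)                  ≡⟨ cong half (ℤ.+-comm i (+ 1)) ⟩
    half (+ 1 + i)                  ≡⟨ cong (λ k → half (+ 1 + k)) eq ⟩
    half (+ 1 + + 2 * half i)       ≡⟨ half-1+2* (half i) ⟩
    half i                          ∎
  1+half-pred : + 1 + half (i - + 1) ≡ half i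
  1+half-pred = begin
    + 1 + half (i - + 1)                    ≡⟨ cong (λ k → + 1 + half (k - + 1)) eq ⟩
    + 1 + half (+ 2 * half i - + 1)         ≡⟨ cong (λ k → + 1 + half k) (pred-double (half i)) ⟩
    + 1 + half (+ 1 + + 2 * (half i - + 1)) ≡⟨ cong (λ k → + 1 + k) (half-1+2* (half i - + 1)) ⟩
    + 1 + (half i - + 1)                    ≡⟨ 1+pred (half i) ⟩
    half i                                  ∎
... | inj₂ eq = inj₁ (begin
    half i                          ≡⟨ half-2* (half i) ⟨
    half (+ 2 * half i)             ≡⟨ cong half (1+i-1 (+ 2 * half i)) ⟨
    half (+ 1 + + 2 * half i - + 1) ≡⟨ cong (λ k → half (k - + 1)) eq ⟨
    half (i - + 1)                  ∎)
  where
  open ≡-Reasoning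
  1+i-1 : ∀ i → + 1 + i - + 1 ≡ i
  1+i-1 = solve-∀

-- Translations of tiles and supertiles

origin : Point
origin = + 0 , + 0

neg : Point → Point
neg (x , y) = - x , - y

⊕-assoc : ∀ a b c → (a ⊕ b) ⊕ c ≡ a ⊕ (b ⊕ c)
⊕-assoc (x , y) (x′ , y′) (x″ , y″) = cong₂ _,_ (ℤ.+-assoc x x′ x″) (ℤ.+-assoc y y′ y″)

⊕-comm : ∀ a b → a ⊕ b ≡ b ⊕ a
⊕-comm (x , y) (x′ , y′) = cong₂ _,_ (ℤ.+-comm x x′) (ℤ.+-comm y y′)

⊕-identityˡ : ∀ a → origin ⊕ a ≡ a
⊕-identityˡ (x , y) = cong₂ _,_ (ℤ.+-identityˡ x) (ℤ.+-identityˡ y)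

⊕-identityʳ : ∀ a → a ⊕ origin ≡ a
⊕-identityʳ (x , y) = cong₂ _,_ (ℤ.+-identityʳ x) (ℤ.+-identityʳ y)

⊕-inverseˡ : ∀ a → neg a ⊕ a ≡ origin
⊕-inverseˡ (x , y) = cong₂ _,_ (ℤ.+-inverseˡ x) (ℤ.+-inverseˡ y)

⊕-inverseʳ : ∀ a → a ⊕ neg a ≡ origin
⊕-inverseʳ a = trans (⊕-comm a (neg a)) (⊕-inverseˡ a)

⊕-neg-cancelʳ : ∀ a d → (a ⊕ d) ⊕ neg d ≡ a
⊕-neg-cancelʳ a d = trans (⊕-assoc a d (neg d)) (trans (cong (a ⊕_) (⊕-inverseʳ d)) (⊕-identityʳ a))

neg-⊕-cancelʳ : ∀ a d → (a ⊕ neg d) ⊕ d ≡ a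
neg-⊕-cancelʳ a d = trans (⊕-assoc a (neg d) d) (trans (cong (a ⊕_) (⊕-inverseˡ d)) (⊕-identityʳ a))

⊕-swapʳ : ∀ a b c → (a ⊕ b) ⊕ c ≡ (a ⊕ c) ⊕ b
⊕-swapʳ a b c = trans (⊕-assoc a b c) (trans (cong (a ⊕_) (⊕-comm b c)) (sym (⊕-assoc a c b)))

double-⊕ : ∀ a b → double (a ⊕ b) ≡ double a ⊕ double b
double-⊕ (x , y) (x′ , y′) = cong₂ _,_ (ℤ.*-distribˡ-+ (+ 2) x x′) (ℤ.*-distribˡ-+ (+ 2) y y′)

shift : Point → Tile → Tile
shift d (r , v) = (r , v ⊕ d)

cells-shift : ∀ d t → cells (shift d t) ≡ map (_⊕ d) (cells t)
cells-shift d (r , v) =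
  cong₂ _∷_ (eq _) (cong₂ _∷_ (eq _) (cong₂ _∷_ (eq _) refl))
  where
  eq : ∀ c → rotateCell r c ⊕ (v ⊕ d) ≡ (rotateCell r c ⊕ v) ⊕ d
  eq c = sym (⊕-assoc (rotateCell r c) v d)

∈-cells-shift : ∀ d t {c} → c ∈ cells t → c ⊕ d ∈ cells (shift d t)
∈-cells-shift d t {c} c∈ = subst (c ⊕ d ∈_) (sym (cells-shift d t)) (∈-map⁺ (_⊕ d) c∈)

∈-cells-shift⁻ : ∀ d t {c} → c ∈ cells (shift d t) → ∃[ c₀ ] c₀ ∈ cells t × c ≡ c₀ ⊕ d
∈-cells-shift⁻ d t {c} c∈ = ∈-map⁻ (_⊕ d) (subst (c ∈_) (cells-shift d t) c∈)

-- At the origin the vertices of the children are numerals, so both sides evaluate to the same list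
-- once the rotation is known. This reduces every statement on a supertile to four finite cases.
ω-shift : ∀ p w → ω (p , w) ≡ map (shift (double w)) (ω (p , origin))
ω-shift r0   w = refl
ω-shift r90  w = refl
ω-shift r180 w = refl
ω-shift r270 w = refl

∈-ω⁻ : ∀ p w {t} → t ∈ ω (p , w) → ∃[ t₀ ] t₀ ∈ ω (p , origin) × t ≡ shift (double w) t₀
∈-ω⁻ p w {t} t∈ = ∈-map⁻ (shift (double w)) (subst (t ∈_) (ω-shift p w) t∈)

∈-ω⁺ : ∀ p w {t} → t ∈ ω (p , origin) → shift (double w) t ∈ ω (p , w)
∈-ω⁺ p w {t} t∈ = subst (shift (double w) t ∈_) (sym (ω-shift p w)) (∈-map⁺ (shift (double w)) t∈)

-- Decision procedures for the finite checks

infix 4 _≟ᶜ_ _≟ᴾ_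

_≟ᶜ_ : DecidableEquality Colour
red   ≟ᶜ red   = yes refl
red   ≟ᶜ blue  = no λ ()
red   ≟ᶜ green = no λ ()
blue  ≟ᶜ red   = no λ ()
blue  ≟ᶜ blue  = yes refl
blue  ≟ᶜ green = no λ ()
green ≟ᶜ red   = no λ ()
green ≟ᶜ blue  = no λ ()
green ≟ᶜ green = yes refl

_≟ᴾ_ : DecidableEquality Point
_≟ᴾ_ = ≡-dec ℤ._≟_ ℤ._≟_

open DecMembership _≟ᴾ_ using (_∈?_)

∀-rotation? : {P : Pred Rotation 0ℓ} → (∀ r → Dec (P r)) → Dec (∀ r → P r)
∀-rotation? P? = map′
  (λ { (a , b , c , d) → λ { r0 → a ; r90 → b ; r180 → c ; r270 → d } })
  (λ f → f r0 , f r90 , f r180 , f r270)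
  (P? r0 ×-dec P? r90 ×-dec P? r180 ×-dec P? r270)

∀-quadrant? : {P : Pred Quadrant 0ℓ} → (∀ q → Dec (P q)) → Dec (∀ q → P q)
∀-quadrant? P? = map′
  (λ { (a , b , c , d) → λ { bottomLeft → a ; bottomRight → b ; topLeft → c ; topRight → d } })
  (λ f → f bottomLeft , f bottomRight , f topLeft , f topRight)
  (P? bottomLeft ×-dec P? bottomRight ×-dec P? topLeft ×-dec P? topRight)

-- The explicit colouring and its local description

orientationColour : Rotation → Colour
orientationColour r0   = red
orientationColour r90  = blue
orientationColour r180 = red
orientationColour r270 = blue

colourByParity : Parity → Colour → Colour
colourByParity 0ℙ k = k
colourByParity 1ℙ k = green

-- Relative to `double w`, the central child has both coordinates equal to 1 or -1, while the
-- coordinates of the outer children are 0, 4 or -4; so the parity of the abscissa detects the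
-- central tile. An outer tile turns its notch towards the centre of the square, so its rotation
-- reveals its quadrant: `r0` bottom-left, `r180` top-right, `r90` bottom-right, `r270` top-left.
col : Tile → Colour
col (r , (x , y)) = colourByParity (parity x) (orientationColour r)

parityColour : Parity → Colour
parityColour 0ℙ = red
parityColour 1ℙ = blue

-- Evaluated at `halve c`, this is the chessboard colouring of the plane by 2×2 blocks.
checker : Cell → Colour
checker (x , y) = parityColour (parity (x + y))

-- The square c lies in 2b + [0,2]² for b = halve c, and double (corner c) is the
-- only vertex of c in 2ℤ².
halve corner : Cell → Point
halve (x , y) = half x , half y
corner c = halve (c ⊕ (+ 1 , + 1))

reflexVertex : Tile → Point
reflexVertex (r , v) = v ⊕ rotate r (+ 1 , + 1)

halve-shift : ∀ c w → halve (c ⊕ double w) ≡ halve c ⊕ w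
halve-shift (x , y) (z , w) = cong₂ _,_ (half-+2* x z) (half-+2* y w)

corner-shift : ∀ c w → corner (c ⊕ double w) ≡ corner c ⊕ w
corner-shift c w = trans (cong halve (⊕-swapʳ c (double w) (+ 1 , + 1))) (halve-shift (c ⊕ (+ 1 , + 1)) w)

reflexVertex-shift : ∀ d t → reflexVertex (shift d t) ≡ reflexVertex t ⊕ d
reflexVertex-shift d (r , v) = ⊕-swapʳ v d (rotate r (+ 1 , + 1))

parity-+2* : ∀ i h → parity (i + + 2 * h) ≡ parity i
parity-+2* i h = begin
  parity (i + + 2 * h)           ≡⟨ parity-+ i (+ 2 * h) ⟩
  parity i ℙ.+ parity (+ 2 * h)  ≡⟨ cong (parity i ℙ.+_) (parity-2* h) ⟩
  parity i ℙ.+ 0ℙ                ≡⟨ ℙ.+-identityʳ (parity i) ⟩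
  parity i                       ∎
  where open ≡-Reasoning

col-shift : ∀ w t → col (shift (double w) t) ≡ col t
col-shift (z , w) (r , (x , y)) = cong (λ p → colourByParity p (orientationColour r)) (parity-+2* x z)

-- Moving the blocks by such a point preserves the chessboard pattern. The vertex of every child is
-- of this kind, since the offsets (0,0), (1,1), (0,4), (4,0) and their rotations are.
EvenPoint : Pred Point 0ℓ
EvenPoint (x , y) = parity (x + y) ≡ 0ℙ

EvenPoint? : Decidable EvenPoint
EvenPoint? (x , y) = parity (x + y) ℙ.≟ 0ℙ

EvenPoint-shift : ∀ w v → EvenPoint v → EvenPoint (v ⊕ double w)
EvenPoint-shift (z , w) (x , y) e =
  trans (cong parity (regroup x y z w)) (trans (parity-+2* (x + y) (z + w)) e)
  where
  regroup : ∀ x y z w → x + + 2 * z + (y + + 2 * w) ≡ x + y + + 2 * (z + w)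
  regroup = solve-∀

checker-shift : ∀ b w → EvenPoint w → checker (b ⊕ w) ≡ checker b
checker-shift (x , y) (z , w) e = cong parityColour (begin
  parity (x + z + (y + w))                 ≡⟨ cong parity (regroup x y z w) ⟩
  parity (x + y + (z + w))                 ≡⟨ parity-+ (x + y) (z + w) ⟩
  parity (x + y) ℙ.+ parity (z + w)        ≡⟨ cong (parity (x + y) ℙ.+_) e ⟩
  parity (x + y) ℙ.+ 0ℙ                    ≡⟨ ℙ.+-identityʳ (parity (x + y)) ⟩
  parity (x + y)                           ∎)
  where
  open ≡-Reasoning
  regroup : ∀ x y z w → x + z + (y + w) ≡ x + y + (z + w)
  regroup = solve-∀

parityColour≢green : ∀ p → parityColour p ≢ green
parityColour≢green 0ℙ ()
parityColour≢green 1ℙ ()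

checker≢green : ∀ b → checker b ≢ green
checker≢green (x , y) = parityColour≢green (parity (x + y))

parityColour-step : ∀ p → parityColour (1ℙ ℙ.+ p) ≢ parityColour p
parityColour-step 0ℙ ()
parityColour-step 1ℙ ()

-- The hypothesis speaks of coordinate sums so that it fits horizontal and vertical neighbours
-- alike.
checker-step : ∀ b b′ → proj₁ b + proj₂ b ≡ + 1 + (proj₁ b′ + proj₂ b′) → checker b ≢ checker b′
checker-step (x , y) (x′ , y′) eq k = parityColour-step (parity (x′ + y′))
  (trans (cong parityColour (sym (trans (cong parity eq) (parity-+ (+ 1) (x′ + y′))))) k)

-- How a single cell of a tile locates its reflex vertex: a green tile surrounds the even lattice
-- point at a corner of the cell, and any other tile fills three quarters of the block of the cell,
-- around the centre of the block.
Local : Tile → Cell → Set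
Local t c = (col t ≡ green × reflexVertex t ≡ double (corner c))
          ⊎ (col t ≡ checker (halve c) × reflexVertex t ≡ double (halve c) ⊕ (+ 1 , + 1))

Local? : ∀ t c → Dec (Local t c)
Local? t c = (col t ≟ᶜ green ×-dec reflexVertex t ≟ᴾ double (corner c))
       ⊎-dec (col t ≟ᶜ checker (halve c) ×-dec reflexVertex t ≟ᴾ double (halve c) ⊕ (+ 1 , + 1))

Local-shift : ∀ w t c → EvenPoint w → Local t c → Local (shift (double w) t) (c ⊕ double w)
Local-shift w t c e (inj₁ (k , i)) = inj₁ (trans (col-shift w t) k , (begin
  reflexVertex (shift (double w) t)              ≡⟨ reflexVertex-shift (double w) t ⟩
  reflexVertex t ⊕ double w                      ≡⟨ cong (_⊕ double w) i ⟩
  double (corner c) ⊕ double w                   ≡⟨ double-⊕ (corner c) w ⟨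
  double (corner c ⊕ w)                          ≡⟨ cong double (corner-shift c w) ⟨
  double (corner (c ⊕ double w)) ∎))
  where open ≡-Reasoning
Local-shift w t c e (inj₂ (k , i)) = inj₂ ((begin
  col (shift (double w) t)                       ≡⟨ col-shift w t ⟩
  col t                                          ≡⟨ k ⟩
  checker (halve c)                              ≡⟨ checker-shift (halve c) w e ⟨
  checker (halve c ⊕ w)                          ≡⟨ cong checker (halve-shift c w) ⟨
  checker (halve (c ⊕ double w)) ∎) , (begin
  reflexVertex (shift (double w) t)              ≡⟨ reflexVertex-shift (double w) t ⟩
  reflexVertex t ⊕ double w                      ≡⟨ cong (_⊕ double w) i ⟩
  double (halve c) ⊕ (+ 1 , + 1) ⊕ double w      ≡⟨ ⊕-swapʳ (double (halve c)) (+ 1 , + 1) (double w) ⟩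
  double (halve c) ⊕ double w ⊕ (+ 1 , + 1)      ≡⟨ cong (_⊕ (+ 1 , + 1)) (double-⊕ (halve c) w) ⟨
  double (halve c ⊕ w) ⊕ (+ 1 , + 1)             ≡⟨ cong (λ b → double b ⊕ (+ 1 , + 1)) (halve-shift c w) ⟨
  double (halve (c ⊕ double w)) ⊕ (+ 1 , + 1)     ∎))
  where open ≡-Reasoning

-- Four rotations, four children and three cells per child give 48 instances, all decided by
-- evaluation.
Local-origin : ∀ p → All (λ t → All (Local t) (cells t)) (ω (p , origin))
Local-origin = from-yes (∀-rotation? λ p → All.all? (λ t → All.all? (Local? t) (cells t)) (ω (p , origin)))

EvenPoint-origin : ∀ p → All (EvenPoint ∘ proj₂) (ω (p , origin))
EvenPoint-origin = from-yes (∀-rotation? λ p → All.all? (EvenPoint? ∘ proj₂) (ω (p , origin)))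

halve-origin : ∀ p → All (λ t → All (λ c → halve c ∈ cells (p , origin)) (cells t)) (ω (p , origin))
halve-origin = from-yes (∀-rotation? λ p →
  All.all? (λ t → All.all? (λ c → halve c ∈? cells (p , origin)) (cells t)) (ω (p , origin)))

vertex-even : ∀ {s t} → t ∈ ω s → EvenPoint (proj₂ t)
vertex-even {p , w} t∈ with t₀ , t₀∈ , refl ← ∈-ω⁻ p w t∈ =
  EvenPoint-shift w (proj₂ t₀) (All.lookup (EvenPoint-origin p) t₀∈)

child-local : ∀ {s t c} → EvenPoint (proj₂ s) → t ∈ ω s → c ∈ cells t → Local t c
child-local {p , w} e t∈ c∈
  with t₀ , t₀∈ , refl ← ∈-ω⁻ p w t∈
  with c₀ , c₀∈ , refl ← ∈-cells-shift⁻ (double w) t₀ c∈ =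
  Local-shift w t₀ c₀ e (All.lookup (All.lookup (Local-origin p) t₀∈) c₀∈)

-- The substitution dissects the doubled tile, so the block around a cell of a child is the double
-- of a cell of its parent.
child-parent : ∀ {s t c} → t ∈ ω s → c ∈ cells t → halve c ∈ cells s
child-parent {p , w} t∈ c∈
  with t₀ , t₀∈ , refl ← ∈-ω⁻ p w t∈
  with c₀ , c₀∈ , refl ← ∈-cells-shift⁻ (double w) t₀ c∈ =
  subst₂ _∈_ (sym (halve-shift c₀ w)) (cong (λ v → cells (p , v)) (⊕-identityˡ w))
    (∈-cells-shift w (p , origin) (All.lookup (All.lookup (halve-origin p) t₀∈) c₀∈))

-- Unique existence in an explicit list becomes an equation between lists, which `refl` proves by
-- running the decision procedure.
∃!-filter : {A : Set} {P : Pred A 0ℓ} (P? : Decidable P) {xs : List A} {x : A} →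
            filter P? xs ≡ x ∷ [] → ∃! _≡_ λ y → y ∈ xs × P y
∃!-filter P? {x = x} eq =
  x , ∈-filter⁻ P? (subst (x ∈_) (sym eq) (here refl)) ,
  λ { (y∈ , Py) → sym (singleton (subst (_ ∈_) eq (∈-filter⁺ P? y∈ Py))) }
  where
  singleton : ∀ {y} → y ∈ x ∷ [] → y ≡ x
  singleton (here y≡x) = y≡x

green-origin : ∀ p → ∃! _≡_ λ t → t ∈ ω (p , origin) × col t ≡ green
green-origin r0   = ∃!-filter (λ t → col t ≟ᶜ green) refl
green-origin r90  = ∃!-filter (λ t → col t ≟ᶜ green) refl
green-origin r180 = ∃!-filter (λ t → col t ≟ᶜ green) refl
green-origin r270 = ∃!-filter (λ t → col t ≟ᶜ green) refl

green-unique : ∀ {s t u} → t ∈ ω s → u ∈ ω s → col t ≡ green → col u ≡ green → t ≡ u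
green-unique {p , w} t∈ u∈ kt ku
  with t₀ , t₀∈ , refl ← ∈-ω⁻ p w t∈
  with u₀ , u₀∈ , refl ← ∈-ω⁻ p w u∈
  with _ , _ , unique ← green-origin p =
  cong (shift (double w)) (trans (sym (unique (t₀∈ , trans (sym (col-shift w t₀)) kt)))
                                 (unique (u₀∈ , trans (sym (col-shift w u₀)) ku)))

-- Overlap at a common reflex vertex, and cells across a segment

atReflexVertex : Rotation → Tile
atReflexVertex r = r , neg (rotate r (+ 1 , + 1))

shift-atReflexVertex : ∀ t → shift (reflexVertex t) (atReflexVertex (proj₁ t)) ≡ t
shift-atReflexVertex (r , v) = cong (r ,_) (trans (⊕-comm (neg k) (v ⊕ k)) (⊕-neg-cancelʳ v k))
  where k = rotate r (+ 1 , + 1)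

-- Each of these tiles covers three of the four cells around the origin, so any two have a cell in
-- common.
overlap-atReflexVertex : ∀ r s → Any (_∈ cells (atReflexVertex s)) (cells (atReflexVertex r))
overlap-atReflexVertex = from-yes (∀-rotation? λ r → ∀-rotation? λ s →
  Any.any? (_∈? cells (atReflexVertex s)) (cells (atReflexVertex r)))

sameReflexVertex⇒meet : ∀ t u → reflexVertex t ≡ reflexVertex u → ∃[ c ] c ∈ cells t × c ∈ cells u
sameReflexVertex⇒meet t u eq with c , c∈t , c∈u ← find (overlap-atReflexVertex (proj₁ t) (proj₁ u)) =
  c ⊕ reflexVertex t ,
  subst (λ z → c ⊕ reflexVertex t ∈ cells z) (shift-atReflexVertex t)
    (∈-cells-shift (reflexVertex t) (atReflexVertex (proj₁ t)) c∈t) ,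
  subst₂ (λ m z → c ⊕ m ∈ cells z) (sym eq) (shift-atReflexVertex u)
    (∈-cells-shift (reflexVertex u) (atReflexVertex (proj₁ u)) c∈u)

-- Crossing a grid line with odd coordinate stays inside a block. Crossing one with even coordinate
-- leads to the adjacent block, of the opposite chessboard colour, while the even corner of the cell
-- stays the same.
neighbours : ∀ e → let a = side₁ e ; b = side₂ e in
  halve a ≡ halve b ⊎ (corner a ≡ corner b × checker (halve a) ≢ checker (halve b))
neighbours (hor (x , y)) with half-pred y
... | inj₁ eq = inj₁ (cong (half x ,_) eq)
... | inj₂ (eq , step) = inj₂
  ( cong (half (x + + 1) ,_) eq
  , checker-step (half x , half y) (half x , half (y - + 1))
      (trans (cong (λ k → half x + k) step) (1+-comm (half x) (half (y - + 1)))) )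
  where
  1+-comm : ∀ x y → x + (+ 1 + y) ≡ + 1 + (x + y)
  1+-comm = solve-∀
neighbours (ver (x , y)) with half-pred x
... | inj₁ eq = inj₁ (cong (_, half y) eq)
... | inj₂ (eq , step) = inj₂
  ( cong (_, half (y + + 1)) eq
  , checker-step (half x , half y) (half (x - + 1) , half y)
      (trans (cong (_+ half y) step) (ℤ.+-assoc (+ 1) (half (x - + 1)) (half y))) )

-- Properness of the colouring

module _ {T : Pred Tile 0ℓ} (chair : IsChairTiling T) where
  open IsChairTiling chair
  open IsTiling isTiling

  parent : ∀ {t} → T t → ∃[ s ] T s × t ∈ ω s
  parent = proj₂ fixed

  overlap⇒≡ : ∀ {t u} → T t → T u → reflexVertex t ≡ reflexVertex u → t ≡ u
  overlap⇒≡ {t} {u} Tt Tu eq with c , c∈t , c∈u ← sameReflexVertex⇒meet t u eq = nonoverlap Tt Tu c∈t c∈u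

  -- The parent of `t` must have an even vertex. It does because the parent is itself a child, by a
  -- second use of `fixed`.
  T-local : ∀ {t c} → T t → c ∈ cells t → Local t c
  T-local Tt c∈t with s , Ts , t∈ ← parent Tt with _ , _ , s∈ ← parent Ts =
    child-local (vertex-even s∈) t∈ c∈t

  -- The common block is the double of a cell lying in both parents. The parents therefore coincide,
  -- and a supertile has only one green tile.
  green-sameBlock : ∀ {t u a b} → T t → T u → a ∈ cells t → b ∈ cells u → halve a ≡ halve b →
                    col t ≡ green → col u ≡ green → t ≡ u
  green-sameBlock {u = u} Tt Tu a∈t b∈u eq kt ku
    with s , Ts , t∈ ← parent Tt
    with s′ , Ts′ , u∈ ← parent Tu =
    green-unique t∈ (subst (λ z → u ∈ ω z) (sym s≡s′) u∈) kt ku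
    where
    s≡s′ : s ≡ s′
    s≡s′ = nonoverlap Ts Ts′ (child-parent t∈ a∈t) (subst (_∈ cells s′) (sym eq) (child-parent u∈ b∈u))

  sameColour⇒≡ : ∀ {t u} e → T t → T u → side₁ e ∈ cells t → side₂ e ∈ cells u →
                 col t ≡ col u → t ≡ u
  sameColour⇒≡ e Tt Tu a∈t b∈u k
    with T-local Tt a∈t | T-local Tu b∈u | neighbours e
  ... | inj₁ (kt , _) | inj₁ (ku , _) | inj₁ h = green-sameBlock Tt Tu a∈t b∈u h kt ku
  ... | inj₁ (_ , it) | inj₁ (_ , iu) | inj₂ (m , _) =
        overlap⇒≡ Tt Tu (trans it (trans (cong double m) (sym iu)))
  ... | inj₂ (_ , it) | inj₂ (_ , iu) | inj₁ h =
        overlap⇒≡ Tt Tu (trans it (trans (cong (λ b → double b ⊕ (+ 1 , + 1)) h) (sym iu)))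
  -- Two outer tiles in adjacent blocks would carry opposite chessboard colours.
  ... | inj₂ (kt , _) | inj₂ (ku , _) | inj₂ (_ , h) = contradiction (trans (sym kt) (trans k ku)) h
  -- In the mixed cases one tile is green and the other has a chessboard colour.
  ... | inj₁ (kt , _) | inj₂ (ku , _) | _ =
        contradiction (trans (sym ku) (trans (sym k) kt)) (checker≢green (halve (side₂ e)))
  ... | inj₂ (kt , _) | inj₁ (ku , _) | _ =
        contradiction (trans (sym kt) (trans k ku)) (checker≢green (halve (side₁ e)))

  -- Each tile contains exactly one of the two cells beside a boundary segment; distinct tiles
  -- cannot contain the same one.
  sharing⇒sides : ∀ {t u} → T t → T u → t ≢ u → ∀ {e} → e ∈∂ t → e ∈∂ u →
                  (side₁ e ∈ cells t × side₂ e ∈ cells u) ⊎ (side₁ e ∈ cells u × side₂ e ∈ cells t)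
  sharing⇒sides Tt Tu t≢u (inj₁ (a∈t , _)) (inj₁ (a∈u , _)) = contradiction (nonoverlap Tt Tu a∈t a∈u) t≢u
  sharing⇒sides Tt Tu t≢u (inj₁ (a∈t , _)) (inj₂ (_ , b∈u)) = inj₁ (a∈t , b∈u)
  sharing⇒sides Tt Tu t≢u (inj₂ (_ , b∈t)) (inj₁ (a∈u , _)) = inj₂ (a∈u , b∈t)
  sharing⇒sides Tt Tu t≢u (inj₂ (_ , b∈t)) (inj₂ (_ , b∈u)) = contradiction (nonoverlap Tt Tu b∈t b∈u) t≢u

  col-isColouring : IsColouring T col
  col-isColouring Tt Tu t≢u (e , e∈t , e∈u) k with sharing⇒sides Tt Tu t≢u e∈t e∈u
  ... | inj₁ (a∈t , b∈u) = t≢u (sameColour⇒≡ e Tt Tu a∈t b∈u k)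
  ... | inj₂ (a∈u , b∈t) = t≢u (sym (sameColour⇒≡ e Tu Tt a∈u b∈t (sym k)))

-- The shape of a supertile

InSquare? : ∀ n Q → Decidable (InSquare n Q)
InSquare? n (a , b) (x , y) = (a ≤? x ×-dec x <? a + + n) ×-dec (b ≤? y ×-dec y <? b + + n)

InQuadrant? : ∀ Q q → Decidable (InQuadrant Q q)
InQuadrant? Q bottomLeft  = InSquare? 2 Q
InQuadrant? Q bottomRight = InSquare? 2 (Q ⊕ (+ 2 , + 0))
InQuadrant? Q topLeft     = InSquare? 2 (Q ⊕ (+ 0 , + 2))
InQuadrant? Q topRight    = InSquare? 2 (Q ⊕ (+ 2 , + 2))

LiesIn? : ∀ t Q q → Dec (LiesIn t Q q)
LiesIn? t Q q = map′ (λ a → All.lookup a) (λ l → All.tabulate l) (All.all? (InQuadrant? Q q) (cells t))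

IsCentral? : ∀ t Q → Dec (IsCentral t Q)
IsCentral? t Q = ∀-quadrant? (λ q → ¬? (LiesIn? t Q q))

interval-+ : ∀ n {a x} d → a ≤ x × x < a + + n → a + d ≤ x + d × x + d < a + d + + n
interval-+ n {a} {x} d (a≤x , x<a+n) =
  ℤ.+-monoˡ-≤ d a≤x , subst (x + d <_) (swap a (+ n) d) (ℤ.+-monoˡ-< d x<a+n)
  where
  swap : ∀ a n d → a + n + d ≡ a + d + n
  swap = solve-∀

InSquare-⊕ : ∀ n {Q c} d → InSquare n Q c → InSquare n (Q ⊕ d) (c ⊕ d)
InSquare-⊕ n (z , w) (h , v) = interval-+ n z h , interval-+ n w v

InQuadrant-⊕ : ∀ q {Q c} d → InQuadrant Q q c → InQuadrant (Q ⊕ d) q (c ⊕ d)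
InQuadrant-⊕ bottomLeft  d = InSquare-⊕ 2 d
InQuadrant-⊕ bottomRight {Q} {c} d i = subst (λ z → InSquare 2 z (c ⊕ d)) (⊕-swapʳ Q _ d) (InSquare-⊕ 2 d i)
InQuadrant-⊕ topLeft     {Q} {c} d i = subst (λ z → InSquare 2 z (c ⊕ d)) (⊕-swapʳ Q _ d) (InSquare-⊕ 2 d i)
InQuadrant-⊕ topRight    {Q} {c} d i = subst (λ z → InSquare 2 z (c ⊕ d)) (⊕-swapʳ Q _ d) (InSquare-⊕ 2 d i)

InSquare-⊕⁻ : ∀ n {Q c} d → InSquare n (Q ⊕ d) (c ⊕ d) → InSquare n Q c
InSquare-⊕⁻ n {Q} {c} d i =
  subst₂ (InSquare n) (⊕-neg-cancelʳ Q d) (⊕-neg-cancelʳ c d) (InSquare-⊕ n (neg d) i)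

InQuadrant-⊕⁻ : ∀ q {Q c} d → InQuadrant (Q ⊕ d) q (c ⊕ d) → InQuadrant Q q c
InQuadrant-⊕⁻ q {Q} {c} d i =
  subst₂ (λ z → InQuadrant z q) (⊕-neg-cancelʳ Q d) (⊕-neg-cancelʳ c d) (InQuadrant-⊕ q (neg d) i)

LiesIn-shift : ∀ d t Q q → LiesIn t Q q → LiesIn (shift d t) (Q ⊕ d) q
LiesIn-shift d t Q q l c∈ with c₀ , c₀∈ , refl ← ∈-cells-shift⁻ d t c∈ = InQuadrant-⊕ q d (l c₀∈)

LiesIn-shift⁻ : ∀ d t Q q → LiesIn (shift d t) (Q ⊕ d) q → LiesIn t Q q
LiesIn-shift⁻ d t Q q l c∈ = InQuadrant-⊕⁻ q d (l (∈-cells-shift d t c∈))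

IsCentral-shift : ∀ d t Q → IsCentral t Q → IsCentral (shift d t) (Q ⊕ d)
IsCentral-shift d t Q k q l = k q (LiesIn-shift⁻ d t Q q l)

IsCentral-shift⁻ : ∀ d t Q → IsCentral (shift d t) (Q ⊕ d) → IsCentral t Q
IsCentral-shift⁻ d t Q k q l = k q (LiesIn-shift d t Q q l)

region-shift : ∀ d P → concatMap cells (map (shift d) P) ≡ map (_⊕ d) (concatMap cells P)
region-shift d P = begin
  concatMap cells (map (shift d) P)          ≡⟨ List.concatMap-map cells (shift d) P ⟩
  concatMap (λ t → cells (shift d t)) P      ≡⟨ List.concatMap-cong (cells-shift d) P ⟩
  concatMap (λ t → map (_⊕ d) (cells t)) P   ≡⟨ List.map-concatMap (_⊕ d) cells P ⟨
  map (_⊕ d) (concatMap cells P)             ∎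
  where open ≡-Reasoning

Occupies-shift : ∀ d P Q q → Occupies P Q q → Occupies (map (shift d) P) (Q ⊕ d) q
Occupies-shift d P Q q occ c = mk⇔ to from
  where
  to : c ∈ concatMap cells (map (shift d) P) → InSquare 4 (Q ⊕ d) c × ¬ InQuadrant (Q ⊕ d) q c
  to c∈ with c₀ , c₀∈ , refl ← ∈-map⁻ (_⊕ d) (subst (c ∈_) (region-shift d P) c∈) =
    let i , o = Equivalence.to (occ c₀) c₀∈ in InSquare-⊕ 4 d i , (λ z → o (InQuadrant-⊕⁻ q d z))
  from : InSquare 4 (Q ⊕ d) c × ¬ InQuadrant (Q ⊕ d) q c → c ∈ concatMap cells (map (shift d) P)
  from (i , o) = subst₂ _∈_ (neg-⊕-cancelʳ c d) (sym (region-shift d P)) (∈-map⁺ (_⊕ d)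
    (Equivalence.from (occ (c ⊕ neg d))
      ( InSquare-⊕⁻ 4 d (subst (InSquare 4 (Q ⊕ d)) (sym (neg-⊕-cancelʳ c d)) i)
      , λ z → o (subst (InQuadrant (Q ⊕ d) q) (neg-⊕-cancelʳ c d) (InQuadrant-⊕ q d z)))))

∃!-shift : ∀ d {P} {F G : Pred Tile 0ℓ} → (∀ t → F t → G (shift d t)) → (∀ t → G (shift d t) → F t) →
           ∃! _≡_ (λ t → t ∈ P × F t) → ∃! _≡_ (λ t → t ∈ map (shift d) P × G t)
∃!-shift d F⇒G G⇒F (t , (t∈ , Ft) , unique) =
  shift d t , (∈-map⁺ (shift d) t∈ , F⇒G t Ft) , unique′
  where
  unique′ : ∀ {u} → _ → shift d t ≡ u
  unique′ (u∈ , Gu) with u₀ , u₀∈ , refl ← ∈-map⁻ (shift d) u∈ =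
    cong (shift d) (unique (u₀∈ , G⇒F u₀ Gu))

SupertileShape-shift : ∀ d {P Q q} → SupertileShape P Q q → SupertileShape (map (shift d) P) (Q ⊕ d) q
SupertileShape-shift d {P} {Q} {q} shape = record
  { occupies   = Occupies-shift d P Q q occupies
  ; inQuadrant = λ q′ q′≢q → ∃!-shift d
      (λ t → LiesIn-shift d t Q q′) (λ t → LiesIn-shift⁻ d t Q q′) (inQuadrant q′ q′≢q)
  ; central    = ∃!-shift d (λ t → IsCentral-shift d t Q) (λ t → IsCentral-shift⁻ d t Q) central
  }
  where open SupertileShape shape

-- The lower-left corner of [0,4]² after rotation about the origin.
square : Rotation → Point
square r0   = + 0 , + 0
square r90  = - + 4 , + 0
square r180 = - + 4 , - + 4
square r270 = + 0 , - + 4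

missing : Rotation → Quadrant
missing r0   = topRight
missing r90  = topLeft
missing r180 = bottomLeft
missing r270 = bottomRight

-- Replaces the quantifier over all cells of a square by one over pairs of `Fin n`, which makes
-- `region⊇` decidable.
InSquare⇒offset : ∀ n Q c → InSquare n Q c → ∃[ i ] ∃[ j ] c ≡ Q ⊕ (+ toℕ {n} i , + toℕ {n} j)
InSquare⇒offset n (a , b) (x , y) (h , v) =
  let i , x≡ = offset a x h ; j , y≡ = offset b y v in i , j , cong₂ _,_ x≡ y≡
  where
  offset : ∀ a x → a ≤ x × x < a + + n → ∃[ i ] x ≡ a + + toℕ {n} i
  offset a x (a≤x , x<a+n) = fromℕ< k<n , sym (begin
    a + + toℕ (fromℕ< k<n)  ≡⟨ cong (λ k → a + + k) (Fin.toℕ-fromℕ< k<n) ⟩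
    a + + ∣ x - a ∣         ≡⟨ cong (λ z → a + z) k≡ ⟩
    a + (x - a)             ≡⟨ cancel a x ⟩
    x                       ∎)
    where
    open ≡-Reasoning
    cancel : ∀ a x → a + (x - a) ≡ x
    cancel = solve-∀
    cancel′ : ∀ a n → a + n - a ≡ n
    cancel′ = solve-∀
    k≡ : + ∣ x - a ∣ ≡ x - a
    k≡ = ℤ.0≤i⇒+∣i∣≡i (ℤ.i≤j⇒0≤j-i a≤x)
    k<n : ∣ x - a ∣ ℕ.< n
    k<n = ℤ.drop‿+<+ (subst₂ _<_ (sym k≡) (cancel′ a (+ n)) (ℤ.+-monoˡ-< (- a) x<a+n))

region⊆ : ∀ p → All (λ c → InSquare 4 (square p) c × ¬ InQuadrant (square p) (missing p) c)
                    (concatMap cells (ω (p , origin)))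
region⊆ = from-yes (∀-rotation? λ p → All.all?
  (λ c → InSquare? 4 (square p) c ×-dec ¬? (InQuadrant? (square p) (missing p) c)) (concatMap cells (ω (p , origin))))

region⊇ : ∀ p (i j : Fin 4) → let c = square p ⊕ (+ toℕ i , + toℕ j) in
          ¬ InQuadrant (square p) (missing p) c → c ∈ concatMap cells (ω (p , origin))
region⊇ = from-yes (∀-rotation? λ p → Fin.all? {n = 4} λ i → Fin.all? {n = 4} λ j →
  ¬? (InQuadrant? (square p) (missing p) (square p ⊕ (+ toℕ i , + toℕ j))) →-dec
  (square p ⊕ (+ toℕ i , + toℕ j)) ∈? concatMap cells (ω (p , origin)))

occupies-origin : ∀ p → Occupies (ω (p , origin)) (square p) (missing p)
occupies-origin p c = mk⇔ (All.lookup (region⊆ p)) from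
  where
  from : InSquare 4 (square p) c × ¬ InQuadrant (square p) (missing p) c → c ∈ concatMap cells (ω (p , origin))
  from (i , o) with m , n , refl ← InSquare⇒offset 4 (square p) c i = region⊇ p m n o

central-origin : ∀ p → ∃! _≡_ λ t → t ∈ ω (p , origin) × IsCentral t (square p)
central-origin r0   = ∃!-filter (λ t → IsCentral? t (square r0)) refl
central-origin r90  = ∃!-filter (λ t → IsCentral? t (square r90)) refl
central-origin r180 = ∃!-filter (λ t → IsCentral? t (square r180)) refl
central-origin r270 = ∃!-filter (λ t → IsCentral? t (square r270)) refl

inQuadrant-origin : ∀ p q → q ≢ missing p → ∃! _≡_ λ t → t ∈ ω (p , origin) × LiesIn t (square p) q
inQuadrant-origin r0   topRight    q≢ = contradiction refl q≢
inQuadrant-origin r90  topLeft     q≢ = contradiction refl q≢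
inQuadrant-origin r180 bottomLeft  q≢ = contradiction refl q≢
inQuadrant-origin r270 bottomRight q≢ = contradiction refl q≢
inQuadrant-origin r0   bottomLeft  _ = ∃!-filter (λ t → LiesIn? t (square r0)   bottomLeft)  refl
inQuadrant-origin r0   bottomRight _ = ∃!-filter (λ t → LiesIn? t (square r0)   bottomRight) refl
inQuadrant-origin r0   topLeft     _ = ∃!-filter (λ t → LiesIn? t (square r0)   topLeft)     refl
inQuadrant-origin r90  bottomLeft  _ = ∃!-filter (λ t → LiesIn? t (square r90)  bottomLeft)  refl
inQuadrant-origin r90  bottomRight _ = ∃!-filter (λ t → LiesIn? t (square r90)  bottomRight) refl
inQuadrant-origin r90  topRight    _ = ∃!-filter (λ t → LiesIn? t (square r90)  topRight)    refl
inQuadrant-origin r180 bottomRight _ = ∃!-filter (λ t → LiesIn? t (square r180) bottomRight) refl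
inQuadrant-origin r180 topLeft     _ = ∃!-filter (λ t → LiesIn? t (square r180) topLeft)     refl
inQuadrant-origin r180 topRight    _ = ∃!-filter (λ t → LiesIn? t (square r180) topRight)    refl
inQuadrant-origin r270 bottomLeft  _ = ∃!-filter (λ t → LiesIn? t (square r270) bottomLeft)  refl
inQuadrant-origin r270 topLeft     _ = ∃!-filter (λ t → LiesIn? t (square r270) topLeft)     refl
inQuadrant-origin r270 topRight    _ = ∃!-filter (λ t → LiesIn? t (square r270) topRight)    refl

supertileShape : ∀ p w → SupertileShape (ω (p , w)) (square p ⊕ double w) (missing p)
supertileShape p w = subst (λ P → SupertileShape P (square p ⊕ double w) (missing p)) (sym (ω-shift p w))
  (SupertileShape-shift (double w) record
    { occupies   = occupies-origin p
    ; inQuadrant = inQuadrant-origin p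
    ; central    = central-origin p
    })

-- Uniqueness of the square occupied by a supertile

leftCell : ∀ q → ∃[ i ] let c = (+ 0 , + toℕ {4} i) in InSquare 4 origin c × ¬ InQuadrant origin q c
leftCell = from-yes (∀-quadrant? λ q → Fin.any? {n = 4} λ i →
  InSquare? 4 origin (+ 0 , + toℕ i) ×-dec ¬? (InQuadrant? origin q (+ 0 , + toℕ i)))

bottomCell : ∀ q → ∃[ i ] let c = (+ toℕ {4} i , + 0) in InSquare 4 origin c × ¬ InQuadrant origin q c
bottomCell = from-yes (∀-quadrant? λ q → Fin.any? {n = 4} λ i →
  InSquare? 4 origin (+ toℕ i , + 0) ×-dec ¬? (InQuadrant? origin q (+ toℕ i , + 0)))

-- Removing a quadrant cannot empty the left column or the bottom row of `Q′`. A remaining cell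
-- there belongs to the patch, hence to the square at `Q`, which bounds the coordinates of `Q`.
occupies⇒≤ : ∀ P Q q Q′ q′ → Occupies P Q q → Occupies P Q′ q′ →
             proj₁ Q ≤ proj₁ Q′ × proj₂ Q ≤ proj₂ Q′
occupies⇒≤ P Q q Q′ q′ occ occ′ =
  subst (proj₁ Q ≤_) (ℤ.+-identityˡ (proj₁ Q′)) (proj₁ (proj₁ (inSquare _ (proj₂ (leftCell q′))))) ,
  subst (proj₂ Q ≤_) (ℤ.+-identityˡ (proj₂ Q′)) (proj₁ (proj₂ (inSquare _ (proj₂ (bottomCell q′)))))
  where
  inSquare : ∀ c → InSquare 4 origin c × ¬ InQuadrant origin q′ c → InSquare 4 Q (c ⊕ Q′)
  inSquare c (i , o) = proj₁ (Equivalence.to (occ (c ⊕ Q′)) (Equivalence.from (occ′ (c ⊕ Q′))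
    ( subst (λ z → InSquare 4 z (c ⊕ Q′)) (⊕-identityˡ Q′) (InSquare-⊕ 4 Q′ i)
    , λ h → o (InQuadrant-⊕⁻ q′ Q′
                (subst (λ z → InQuadrant z q′ (c ⊕ Q′)) (sym (⊕-identityˡ Q′)) h)))))

-- `FollowsRule` quantifies over every square that a supertile occupies; this identifies it with the
-- computed one.
occupies-unique : ∀ P Q q Q′ q′ → Occupies P Q q → Occupies P Q′ q′ → Q ≡ Q′
occupies-unique P Q q Q′ q′ occ occ′ =
  let x≤x′ , y≤y′ = occupies⇒≤ P Q q Q′ q′ occ occ′
      x′≤x , y′≤y = occupies⇒≤ P Q′ q′ Q q occ′ occ
  in cong₂ _,_ (ℤ.≤-antisym x≤x′ x′≤x) (ℤ.≤-antisym y≤y′ y′≤y)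

-- The rule and the colouring it determines

Rule : Colour → Tile → Point → Set
Rule k t Q = (IsCentral t Q → k ≡ green) × (∀ q → LiesIn t Q q → k ≡ quadrantColour q)

rule-origin : ∀ p → All (λ t → Rule (col t) t (square p)) (ω (p , origin))
rule-origin = from-yes (∀-rotation? λ p → All.all?
  (λ t → (IsCentral? t (square p) →-dec col t ≟ᶜ green)
   ×-dec ∀-quadrant? (λ q → LiesIn? t (square p) q →-dec col t ≟ᶜ quadrantColour q)) (ω (p , origin)))

col-followsRule : ∀ T → FollowsRule T col
col-followsRule T {p , w} _ Q q occ {t} t∈
  with refl ← occupies-unique (ω (p , w)) Q q (square p ⊕ double w) (missing p) occ
                (SupertileShape.occupies (supertileShape p w))
  with t₀ , t₀∈ , refl ← ∈-ω⁻ p w t∈ =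
  let centralRule , quadrantRule = All.lookup (rule-origin p) t₀∈ in
  (λ k → trans (col-shift w t₀) (centralRule (IsCentral-shift⁻ (double w) t₀ (square p) k))) ,
  (λ q′ l → trans (col-shift w t₀) (quadrantRule q′ (LiesIn-shift⁻ (double w) t₀ (square p) q′ l)))

central-or-liesIn : ∀ t Q → IsCentral t Q ⊎ ∃[ q ] LiesIn t Q q
central-or-liesIn t Q with LiesIn? t Q bottomLeft | LiesIn? t Q bottomRight | LiesIn? t Q topLeft | LiesIn? t Q topRight
... | yes l | _     | _     | _     = inj₂ (bottomLeft , l)
... | no _  | yes l | _     | _     = inj₂ (bottomRight , l)
... | no _  | no _  | yes l | _     = inj₂ (topLeft , l)
... | no _  | no _  | no _  | yes l = inj₂ (topRight , l)
... | no a  | no b  | no c  | no d  =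
  inj₁ λ { bottomLeft → a ; bottomRight → b ; topLeft → c ; topRight → d }

rule-determines : ∀ {k k′} t Q → Rule k t Q → Rule k′ t Q → k ≡ k′
rule-determines t Q (centralRule , quadrantRule) (centralRule′ , quadrantRule′) with central-or-liesIn t Q
... | inj₁ k       = trans (centralRule k) (sym (centralRule′ k))
... | inj₂ (q , l) = trans (quadrantRule q l) (sym (quadrantRule′ q l))

-- Both colourings obey the rule, and the rule leaves no choice, as each tile is central or lies in
-- some quadrant.
followsRule⇒≡col : ∀ {T c} → FollowsRule T c → ∀ {s t} → T s → t ∈ ω s → c t ≡ col t
followsRule⇒≡col {T} rule {p , w} {t} Ts t∈ =
  rule-determines t (square p ⊕ double w)
    (rule Ts (square p ⊕ double w) (missing p) occupies t∈)
    (col-followsRule T Ts (square p ⊕ double w) (missing p) occupies t∈)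
  where open SupertileShape (supertileShape p w)

-- The lower bound: three mutually adjacent tiles

+-pred-comm : ∀ i j → i + j - + 1 ≡ i - + 1 + j
+-pred-comm = solve-∀

shiftSegment : Point → Segment → Segment
shiftSegment d (hor p) = hor (p ⊕ d)
shiftSegment d (ver p) = ver (p ⊕ d)

side₁-shift : ∀ d e → side₁ (shiftSegment d e) ≡ side₁ e ⊕ d
side₁-shift d (hor p) = refl
side₁-shift d (ver p) = refl

side₂-shift : ∀ d e → side₂ (shiftSegment d e) ≡ side₂ e ⊕ d
side₂-shift (z , w) (hor (x , y)) = cong (x + z ,_) (+-pred-comm y w)
side₂-shift (z , w) (ver (x , y)) = cong (_, y + w) (+-pred-comm x z)

-- The central, bottom-right and bottom-left tiles of ω(C). In this order the tile of smaller index
-- lies above or to the right of the shared segment, on the side of `side₁`.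
triangle : Fin 3 → Tile
triangle zero             = r0  , (+ 1 , + 1)
triangle (suc zero)       = r90 , (+ 4 , + 0)
triangle (suc (suc zero)) = r0  , (+ 0 , + 0)

triangle∈ω : ∀ i → triangle i ∈ ω (r0 , origin)
triangle∈ω zero             = there (here refl)
triangle∈ω (suc zero)       = there (there (there (here refl)))
triangle∈ω (suc (suc zero)) = here refl

-- Different values of `col` certify that the tiles are distinct, and this survives translation by
-- `double w`.
triangle-sides : ∀ i j → i Fin.< j → col (triangle i) ≢ col (triangle j) ×
  ∃[ e ] side₁ e ∈ cells (triangle i) × side₂ e ∈ cells (triangle j)
triangle-sides zero       (suc zero)       _ = (λ ()) , hor (+ 2 , + 1) ,
  from-yes ((+ 2 , + 1) ∈? cells (triangle zero)) , from-yes ((+ 2 , + 0) ∈? cells (triangle (suc zero)))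
triangle-sides zero       (suc (suc zero)) _ = (λ ()) , hor (+ 1 , + 1) ,
  from-yes ((+ 1 , + 1) ∈? cells (triangle zero)) , from-yes ((+ 1 , + 0) ∈? cells (triangle (suc (suc zero))))
triangle-sides (suc zero) (suc (suc zero)) _ = (λ ()) , ver (+ 2 , + 0) ,
  from-yes ((+ 2 , + 0) ∈? cells (triangle (suc zero))) , from-yes ((+ 1 , + 0) ∈? cells (triangle (suc (suc zero))))
triangle-sides (suc zero)       (suc zero)       (s≤s ())
triangle-sides (suc (suc zero)) (suc zero)       (s≤s ())
triangle-sides (suc (suc zero)) (suc (suc zero)) (s≤s (s≤s ()))

colourIndex : Colour → Fin 3
colourIndex red   = zero
colourIndex blue  = suc zero
colourIndex green = suc (suc zero)

colourIndex-injective : ∀ {k l} → colourIndex k ≡ colourIndex l → k ≡ l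
colourIndex-injective {red}   {red}   _ = refl
colourIndex-injective {blue}  {blue}  _ = refl
colourIndex-injective {green} {green} _ = refl

module _ {T : Pred Tile 0ℓ} (chair : IsChairTiling T) where
  open IsChairTiling chair
  open IsTiling isTiling

  child : ∀ {s t} → T s → t ∈ ω s → T t
  child Ts t∈ = proj₁ fixed (_ , Ts , t∈)

  -- Some tile covers the origin; its rotation is undone by passing to a child whose relative
  -- rotation is the inverse.
  unrotatedTile : ∃[ w ] T (r0 , w)
  unrotatedTile with covers origin
  ... | (r0   , _) , Ts , _ = _ , Ts
  ... | (r90  , _) , Ts , _ = _ , child Ts (there (there (here refl)))
  -- No child in `ωC` is turned by 180 degrees, so two generations of the `r90` child are taken.
  ... | (r180 , _) , Ts , _ = _ , child (child Ts (there (there (there (here refl))))) (there (there (there (here refl))))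
  ... | (r270 , _) , Ts , _ = _ , child Ts (there (there (there (here refl))))

  touching : ∀ {t u} e → T t → T u → t ≢ u → side₁ e ∈ cells t → side₂ e ∈ cells u → ShareSegment t u
  touching e Tt Tu t≢u a∈t b∈u = e ,
    inj₁ (a∈t , λ b∈t → t≢u (nonoverlap Tt Tu b∈t b∈u)) ,
    inj₂ ((λ a∈u → t≢u (nonoverlap Tt Tu a∈t a∈u)) , b∈u)

  -- With fewer than three colours, the pigeonhole principle gives two of the three pairwise
  -- adjacent tiles the same colour.
  atLeast3 : ∀ k → Colourable T k → 3 ℕ.≤ k
  atLeast3 k (c , colouring) = ℕ.≮⇒≥ λ k<3 →
    let i , j , i<j , same = Fin.pigeonhole k<3 (c ∘ tile)
        differ , e , a∈ , b∈ = triangle-sides i j i<j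
        tᵢ≢tⱼ : tile i ≢ tile j
        tᵢ≢tⱼ eq = differ (trans (sym (col-shift w (triangle i))) (trans (cong col eq) (col-shift w (triangle j))))
    in colouring (inT i) (inT j) tᵢ≢tⱼ
         (touching (shiftSegment (double w) e) (inT i) (inT j) tᵢ≢tⱼ
           (subst (_∈ cells (tile i)) (sym (side₁-shift (double w) e)) (∈-cells-shift (double w) (triangle i) a∈))
           (subst (_∈ cells (tile j)) (sym (side₂-shift (double w) e)) (∈-cells-shift (double w) (triangle j) b∈)))
         same
    where
    w = proj₁ unrotatedTile
    tile : Fin 3 → Tile
    tile i = shift (double w) (triangle i)
    inT : ∀ i → T (tile i)
    inT i = child (proj₂ unrotatedTile) (∈-ω⁺ r0 w (triangle∈ω i))

theorem3p3 : (T : Pred Tile 0ℓ) → IsChairTiling T →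
    SmallestNumberOfColours T 3
    × (∀ {s} → T s → ∃[ Q ] ∃[ q ] SupertileShape (ω s) Q q)
    × (∃[ c ] FollowsRule T c)
    × (∀ c → FollowsRule T c → IsColouring T c)
theorem3p3 T chair =
  ((colourIndex ∘ col , λ Tt Tu t≢u share eq → col-isColouring chair Tt Tu t≢u share (colourIndex-injective eq)) ,
    atLeast3 chair) ,
  (λ { {p , w} _ → square p ⊕ double w , missing p , supertileShape p w }) ,
  (col , col-followsRule T) ,
  -- Every tile of `T` is a child, so `c` agrees with `col` on `T` and inherits its properness.
  λ c rule Tt Tu t≢u share eq →
    let s , Ts , t∈ = parent chair Tt
        s′ , Ts′ , u∈ = parent chair Tu
    in col-isColouring chair Tt Tu t≢u share
         (trans (sym (followsRule⇒≡col rule Ts t∈)) (trans eq (followsRule⇒≡col rule Ts′ u∈)))
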